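{- Let $G$ be a finite group of order $n$, and $X\subseteq G$ a non-empty proper subset of size $m$. If $m>n-\frac12-\sqrt{n-\frac34}$, then $X$ is $2$-generic in $G$. Hence if $m<\frac12+\sqrt{n-\frac34}$, then $X$ is not $2$-large in $G$.
   Context: For $X\subseteq G$: $X$ is $k$-large in $G$ if the intersection of any $k$ left translates $g_1X\cap\dots\cap g_kX$ ($g_i\in G$) is non-empty; $X$ is $k$-generic in $G$ if there are $g_1,\dots,g_k\in G$ with $G=\bigcup_{i\le k}g_iX$. -}

module Defs where

open import Algebra.Bundles using (Group)
open import Data.Fin.Base using (Fin)
open import Data.Integer.Base using (+_)
open import Data.Nat.Base using (ℕ)
open import Data.Product.Base using (∃; _×_; _,_; proj₁; proj₂; map₂)
open import Data.Rational.Base hiding (_⊔_)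
open import Data.Rational.Properties
open import Data.Rational.Solver using (module +-*-Solver)
open import Data.Sum.Base using (_⊎_; inj₁; inj₂)
import Data.Sum.Base as Sum
open import Function.Bundles using (Inverse)
open import Level using (Level; 0ℓ; _⊔_)
open import Relation.Binary.Bundles using (Setoid)
import Relation.Binary.Construct.On as On
open import Relation.Binary.PropositionalEquality
  using (_≡_; refl; sym; trans; cong; subst; subst₂; setoid)
open import Relation.Nullary.Decidable.Core using (yes; no)
open import Relation.Nullary.Negation.Core using (¬_)
open import Relation.Unary using (Pred; _∈_; Satisfiable; Universal; ⋃; ⋂)

private variable
  a ℓ p : Level

HasSize : Setoid a ℓ → ℕ → Set (a ⊔ ℓ)
HasSize S n = Inverse S (setoid (Fin n))

-- Elements of X are compared by the equality of S alone; the membership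
-- proofs are ignored.
subsetoid : (S : Setoid a ℓ) → Pred (Setoid.Carrier S) p → Setoid (a ⊔ p) ℓ
subsetoid S X = On.setoid S (proj₁ {B = X})

module _ (G : Group a ℓ) where
  open Group G using (Carrier; _≈_; _∙_)

  leftTranslate : Carrier → Pred Carrier p → Pred Carrier (a ⊔ ℓ ⊔ p)
  leftTranslate g X y = ∃ λ x → x ∈ X × y ≈ g ∙ x

  IsLarge : ℕ → Pred Carrier p → Set (a ⊔ ℓ ⊔ p)
  IsLarge k X = (g : Fin k → Carrier) →
    Satisfiable (⋂ (Fin k) λ i → leftTranslate (g i) X)

  IsGeneric : ℕ → Pred Carrier p → Set (a ⊔ ℓ ⊔ p)
  IsGeneric k X = ∃ λ (g : Fin k → Carrier) →
    Universal (⋃ (Fin k) λ i → leftTranslate (g i) X)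

record ℝ : Set₁ where
  field
    L U         : Pred ℚ 0ℓ
    L-inhabited : ∃ L
    U-inhabited : ∃ U
    L-lower     : ∀ {q r} → q < r → L r → L q
    U-upper     : ∀ {q r} → q < r → U q → U r
    L-open      : ∀ {q} → L q → ∃ λ r → q < r × L r
    U-open      : ∀ {r} → U r → ∃ λ q → q < r × U q
    disjoint    : ∀ {q} → ¬ (L q × U q)
    located     : ∀ {q r} → q < r → L q ⊎ U r

infix 4 _<ℝ_ _>ℝ_

_<ℝ_ _>ℝ_ : ℝ → ℝ → Set
x <ℝ y = ∃ λ q → ℝ.U x q × ℝ.L y q
x >ℝ y = y <ℝ x

fromℕ : ℕ → ℚ
fromℕ n = + n / 1

private
  q-1<q : ∀ q → q - 1ℚ < q
  q-1<q q = subst (q - 1ℚ <_) (+-identityʳ q) (+-monoʳ-< q (negative⁻¹ (- 1ℚ)))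

  q<q+1 : ∀ q → q < q + 1ℚ
  q<q+1 q = subst (_< q + 1ℚ) (+-identityʳ q) (+-monoʳ-< q (positive⁻¹ 1ℚ))

fromℚ : ℚ → ℝ
fromℚ x = record
  { L           = _< x
  ; U           = x <_
  ; L-inhabited = x - 1ℚ , q-1<q x
  ; U-inhabited = x + 1ℚ , q<q+1 x
  ; L-lower     = <-trans
  ; U-upper     = λ q<r x<q → <-trans x<q q<r
  ; L-open      = <-dense
  ; U-open      = λ x<r → let q , x<q , q<r = <-dense x<r in q , q<r , x<q
  ; disjoint    = λ (q<x , x<q) → <-asym q<x x<q
  ; located     = located
  }
  where
  located : ∀ {q r} → q < r → q < x ⊎ x < r
  located {q} q<r with q <? x
  ... | yes q<x = inj₁ q<x
  ... | no  q≮x = inj₂ (≤-<-trans (≮⇒≥ q≮x) q<r)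

infixl 6 _+ℝ_ _-ℝ_

private
  module _ where
    open +-*-Solver

    s+[r-s]≡r : ∀ s r → s + (r - s) ≡ r
    s+[r-s]≡r = solve 2 (λ s r → s :+ (r :- s) := r) refl

    s-[s-r]≡r : ∀ s r → s - (s - r) ≡ r
    s-[s-r]≡r = solve 2 (λ s r → s :- (s :- r) := r) refl

    [s+r]-s≡r : ∀ s r → (s + r) - s ≡ r
    [s+r]-s≡r = solve 2 (λ s r → (s :+ r) :- s := r) refl

  subʳ-antitone : ∀ s {q r} → q < r → s - r < s - q
  subʳ-antitone s q<r = +-monoʳ-< s (neg-antimono-< q<r)

-- Only a rational has to be added to, or a real subtracted from a rational.
_+ℝ_ : ℚ → ℝ → ℝ
s +ℝ x = record
  { L           = λ q → L (q - s)
  ; U           = λ q → U (q - s)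
  ; L-inhabited = let q , Lq = L-inhabited in s + q , subst L (sym ([s+r]-s≡r s q)) Lq
  ; U-inhabited = let q , Uq = U-inhabited in s + q , subst U (sym ([s+r]-s≡r s q)) Uq
  ; L-lower     = λ q<r → L-lower (+-monoˡ-< (- s) q<r)
  ; U-upper     = λ q<r → U-upper (+-monoˡ-< (- s) q<r)
  ; L-open      = λ {q} Lq → let r , q-s<r , Lr = L-open Lq in
                    s + r
                    , subst (_< s + r) (s+[r-s]≡r s q) (+-monoʳ-< s q-s<r)
                    , subst L (sym ([s+r]-s≡r s r)) Lr
  ; U-open      = λ {r} Ur → let q , q<r-s , Uq = U-open Ur in
                    s + q
                    , subst (s + q <_) (s+[r-s]≡r s r) (+-monoʳ-< s q<r-s)
                    , subst U (sym ([s+r]-s≡r s q)) Uq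
  ; disjoint    = disjoint
  ; located     = λ q<r → located (+-monoˡ-< (- s) q<r)
  }
  where open ℝ x

_-ℝ_ : ℚ → ℝ → ℝ
s -ℝ x = record
  { L           = λ q → U (s - q)
  ; U           = λ q → L (s - q)
  ; L-inhabited = let q , Uq = U-inhabited in s - q , subst U (sym (s-[s-r]≡r s q)) Uq
  ; U-inhabited = let q , Lq = L-inhabited in s - q , subst L (sym (s-[s-r]≡r s q)) Lq
  ; L-lower     = λ q<r → U-upper (subʳ-antitone s q<r)
  ; U-upper     = λ q<r → L-lower (subʳ-antitone s q<r)
  ; L-open      = λ {q} Us-q → let r , r<s-q , Ur = U-open Us-q in
                    s - r
                    , subst (_< s - r) (s-[s-r]≡r s q) (subʳ-antitone s r<s-q)
                    , subst U (sym (s-[s-r]≡r s r)) Ur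
  ; U-open      = λ {r} Ls-r → let q , s-r<q , Lq = L-open Ls-r in
                    s - q
                    , subst (s - q <_) (s-[s-r]≡r s r) (subʳ-antitone s s-r<q)
                    , subst L (sym (s-[s-r]≡r s q)) Lq
  ; disjoint    = λ (Us-q , Ls-q) → disjoint (Ls-q , Us-q)
  ; located     = λ q<r → Sum.swap (located (subʳ-antitone s q<r))
  }
  where open ℝ x

private
  <⇒0<- : ∀ {q r} → q < r → 0ℚ < r - q
  <⇒0<- {q} {r} q<r = subst (_< r - q) (+-inverseʳ q) (+-monoˡ-< (- q) q<r)

  0<-⇒< : ∀ {q r} → 0ℚ < r - q → q < r
  0<-⇒< {q} {r} 0<r-q =
    subst₂ _<_ (+-identityʳ q) (s+[r-s]≡r q r) (+-monoʳ-< q 0<r-q)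

  0<* : ∀ {q r} → 0ℚ < q → 0ℚ < r → 0ℚ < q * r
  0<* {q} {r} 0<q 0<r =
    subst (_< q * r) (*-zeroʳ q) (*-monoʳ-<-pos q {{positive 0<q}} 0<r)

  0≤* : ∀ {q r} → 0ℚ ≤ q → 0ℚ ≤ r → 0ℚ ≤ q * r
  0≤* {q} {r} 0≤q 0≤r =
    subst (_≤ q * r) (*-zeroʳ q) (*-monoˡ-≤-nonNeg q {{nonNegative 0≤q}} 0≤r)

  square-mono-< : ∀ {q r} → 0ℚ ≤ q → q < r → q * q < r * r
  square-mono-< {q} {r} 0≤q q<r = ≤-<-trans
    (*-monoˡ-≤-nonNeg q {{nonNegative 0≤q}} (<⇒≤ q<r))
    (*-monoˡ-<-pos r {{positive (≤-<-trans 0≤q q<r)}} q<r)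

  -- For c² > x, the map q ↦ (cq + x)/(q + c) moves q ≥ 0 towards √x without
  -- reaching it; here c = x + 1.
  module Step {x q : ℚ} (0≤x : 0ℚ ≤ x) (0≤q : 0ℚ ≤ q) where
    c d : ℚ
    c = x + 1ℚ
    d = q + c

    0<c : 0ℚ < c
    0<c = ≤-<-trans 0≤x (q<q+1 x)

    0<d : 0ℚ < d
    0<d = +-mono-≤-< 0≤q 0<c

    instance
      d-positive : Positive d
      d-positive = positive 0<d
      d-nonZero : NonZero d
      d-nonZero = pos⇒nonZero d

    t next : ℚ
    t = 1/ d
    next = (c * q + x) * t

    0<t : 0ℚ < t
    0<t = positive⁻¹ t {{1/pos⇒pos d}}

    dt≡1 : d * t ≡ 1ℚ
    dt≡1 = *-inverseʳ d

    0<c²-x : 0ℚ < c * c - x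
    0<c²-x = subst (0ℚ <_) (sym (eq x)) (≤-<-trans (0≤* 0≤x 0≤x) (<-trans′ (q<q+1 (x * x))))
      where
      open +-*-Solver
      eq : ∀ x → (x + 1ℚ) * (x + 1ℚ) - x ≡ x * x + 1ℚ + x
      eq = solve 1 (λ x → (x :+ con 1ℚ) :* (x :+ con 1ℚ) :- x := x :* x :+ con 1ℚ :+ x) refl
      <-trans′ : x * x < x * x + 1ℚ → x * x < x * x + 1ℚ + x
      <-trans′ h = subst (_< x * x + 1ℚ + x) (+-identityʳ (x * x)) (+-mono-<-≤ h 0≤x)

    k : ℚ
    k = t * t * (c * c - x)

    0<k : 0ℚ < k
    0<k = 0<* (0<* 0<t 0<t) 0<c²-x

    module _ where
      open +-*-Solver

      next-q : next - q ≡ t * (x - q * q)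
      next-q = trans
        (cong (λ u → next - u) (sym (trans (cong (q *_) dt≡1) (*-identityʳ q))))
        (solve 4 (λ x q c t →
            (c :* q :+ x) :* t :- q :* ((q :+ c) :* t) := t :* (x :- q :* q))
          refl x q c t)

      q-next : q - next ≡ t * (q * q - x)
      q-next = trans
        (cong (λ u → u - next) (sym (trans (cong (q *_) dt≡1) (*-identityʳ q))))
        (solve 4 (λ x q c t →
            q :* ((q :+ c) :* t) :- (c :* q :+ x) :* t := t :* (q :* q :- x))
          refl x q c t)

      x≡ : x * ((d * t) * (d * t)) ≡ x
      x≡ = trans (cong (λ u → x * (u * u)) dt≡1) (*-identityʳ x)

      x-next² : x - next * next ≡ k * (x - q * q)
      x-next² = trans (cong (λ u → u - next * next) (sym x≡))
        (solve 4 (λ x q c t →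
            x :* (((q :+ c) :* t) :* ((q :+ c) :* t))
              :- ((c :* q :+ x) :* t) :* ((c :* q :+ x) :* t)
            := t :* t :* (c :* c :- x) :* (x :- q :* q))
          refl x q c t)

      next²-x : next * next - x ≡ k * (q * q - x)
      next²-x = trans (cong (λ u → next * next - u) (sym x≡))
        (solve 4 (λ x q c t →
            ((c :* q :+ x) :* t) :* ((c :* q :+ x) :* t)
              :- x :* (((q :+ c) :* t) :* ((q :+ c) :* t))
            := t :* t :* (c :* c :- x) :* (q :* q :- x))
          refl x q c t)

    up : q * q < x → q < next × next * next < x
    up q²<x = 0<-⇒< (subst (0ℚ <_) (sym next-q) (0<* 0<t 0<x-q²))
            , 0<-⇒< (subst (0ℚ <_) (sym x-next²) (0<* 0<k 0<x-q²))
      where 0<x-q² = <⇒0<- q²<x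

    down : x < q * q → next < q × x < next * next
    down x<q² = 0<-⇒< (subst (0ℚ <_) (sym q-next) (0<* 0<t 0<q²-x))
              , 0<-⇒< (subst (0ℚ <_) (sym next²-x) (0<* 0<k 0<q²-x))
      where 0<q²-x = <⇒0<- x<q²

    0<next : 0ℚ < q → 0ℚ < next
    0<next 0<q = 0<* (+-mono-<-≤ (0<* 0<c 0<q) 0≤x) 0<t

-- For negative x this cut is 0.
√_ : ℚ → ℝ
√ x = record
  { L           = L
  ; U           = U
  ; L-inhabited = - 1ℚ , inj₁ (negative⁻¹ (- 1ℚ))
  ; U-inhabited = U-inhabited
  ; L-lower     = L-lower
  ; U-upper     = λ q<r (0<q , x<q²) →
                    <-trans 0<q q<r , <-trans x<q² (square-mono-< (<⇒≤ 0<q) q<r)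
  ; L-open      = L-open
  ; U-open      = U-open
  ; disjoint    = disjoint
  ; located     = located
  }
  where
  L U : Pred ℚ 0ℓ
  L q = q < 0ℚ ⊎ q * q < x
  U q = 0ℚ < q × x < q * q

  U-inhabited : ∃ U
  U-inhabited with x <? 0ℚ
  ... | yes x<0 = 1ℚ , positive⁻¹ 1ℚ , <-trans x<0 (positive⁻¹ 1ℚ)
  ... | no  x≮0 = c , 0<c , 0<-⇒< 0<c²-x
    where open Step (≮⇒≥ x≮0) (≤-refl {0ℚ})

  L-lower : ∀ {q r} → q < r → L r → L q
  L-lower q<r (inj₁ r<0) = inj₁ (<-trans q<r r<0)
  L-lower {q} q<r (inj₂ r²<x) with q <? 0ℚ
  ... | yes q<0 = inj₁ q<0
  ... | no  q≮0 = inj₂ (<-trans (square-mono-< (≮⇒≥ q≮0) q<r) r²<x)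

  L-open : ∀ {q} → L q → ∃ λ r → q < r × L r
  L-open (inj₁ q<0) = map₂ (map₂ inj₁) (<-dense q<0)
  L-open {q} (inj₂ q²<x) with q <? 0ℚ
  ... | yes q<0 = map₂ (map₂ inj₁) (<-dense q<0)
  ... | no  q≮0 = next , map₂ inj₂ (up q²<x)
    where
    0≤q = ≮⇒≥ q≮0
    open Step (≤-trans (0≤* 0≤q 0≤q) (<⇒≤ q²<x)) 0≤q

  U-open : ∀ {r} → U r → ∃ λ q → q < r × U q
  U-open {r} (0<r , x<r²) with x <? 0ℚ
  ... | yes x<0 = let q , 0<q , q<r = <-dense 0<r in
                  q , q<r , 0<q , <-trans x<0 (0<* 0<q 0<q)
  ... | no  x≮0 = let q<r , x<q² = down x<r² in next , q<r , 0<next 0<r , x<q²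
    where open Step (≮⇒≥ x≮0) (<⇒≤ 0<r)

  disjoint : ∀ {q} → ¬ (L q × U q)
  disjoint (inj₁ q<0  , 0<q , _)    = <-asym q<0 0<q
  disjoint (inj₂ q²<x , _   , x<q²) = <-asym q²<x x<q²

  located : ∀ {q r} → q < r → L q ⊎ U r
  located {q} q<r with q <? 0ℚ | q * q <? x
  ... | yes q<0 | _        = inj₁ (inj₁ q<0)
  ... | no  _   | yes q²<x = inj₁ (inj₂ q²<x)
  ... | no  q≮0 | no  q²≮x =
    inj₂ (≤-<-trans 0≤q q<r , ≤-<-trans (≮⇒≥ q²≮x) (square-mono-< 0≤q q<r))
    where 0≤q = ≮⇒≥ q≮0

{-# OPTIONS --safe #-}
-- If k² − k + 1 < n, then k elements of G have at most k² − k + 1 < n quotients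
-- a b⁻¹, since the k diagonal ones all equal ε; so some g is no quotient at all.
-- For the elements of G ∖ X this says that g (G ∖ X) misses G ∖ X, hence
-- G = X ∪ g X; for the elements of X it says that g X misses X.
module Submission where

open import Defs
open import Algebra.Bundles using (Group)
import Algebra.Properties.Group as GroupProperties
open import Data.Fin.Base
  using (Fin; zero; suc; combine; remQuot; punchIn; punchOut)
open import Data.Fin.Properties
  using (_≟_; any?; ¬∀⟶∃¬; injective⇒≤; remQuot-combine; punchIn-punchOut;
         punchOut-injective; suc-injective)
open import Data.Integer.Base using (+_)
import Data.Integer.Base as ℤ
import Data.Integer.Properties as ℤ
open import Data.Nat.Base using (ℕ; zero; suc)
import Data.Nat.Base as ℕ
import Data.Nat.Coprimality as Coprimality
import Data.Nat.Properties as ℕ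
open import Data.Product.Base using (∃; _×_; _,_; proj₁; proj₂)
open import Data.Rational.Base
  using (ℚ; mkℚ; ½; 0ℚ; 1ℚ; _/_; _+_; _-_; _*_; -_; _<_; _≤_;
         nonNegative; positive)
open import Data.Rational.Properties
  using (normalize-coprime; normalize-nonNeg; nonNegative⁻¹; drop-*<*; <⇒≤;
         <-trans; ≤-<-trans; <-irrefl; +-mono-≤; +-monoˡ-<; +-monoʳ-<;
         neg-antimono-<; *-monoˡ-<-pos; *-monoˡ-≤-nonNeg)
open import Data.Rational.Solver using (module +-*-Solver)
open import Data.Sum.Base using (inj₁; inj₂)
open import Function.Base using (_∘_)
open import Function.Bundles using (Inverse; Injection)
open import Function.Definitions using (Injective)
open import Function.Properties.Inverse using (Inverse⇒Injection)
open import Relation.Binary.Definitions using (_Respects_)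
open import Relation.Binary.PropositionalEquality
  using (_≡_; _≢_; refl; sym; trans; cong; cong₂; subst; subst₂)
open import Relation.Nullary.Decidable.Core using (Dec; yes; no; map′; decidable-stable)
open import Relation.Nullary.Negation.Core using (¬_; contradiction)
open import Relation.Unary using (Pred; Satisfiable; Universal; Decidable; _∈_)

-- The gcd in `_/_` is stuck for a variable `n`; this normal form exposes numerator and denominator,
-- so that sums and products compute.
fromℕ≡mkℚ : ∀ n → fromℕ n ≡ mkℚ (+ n) 0 (Coprimality.sym (Coprimality.1-coprimeTo n))
fromℕ≡mkℚ n = normalize-coprime (Coprimality.sym (Coprimality.1-coprimeTo n))

fromℕ-homo-+ : ∀ m n → fromℕ (m ℕ.+ n) ≡ fromℕ m + fromℕ n
fromℕ-homo-+ m n = sym (trans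
  (cong₂ _+_ (fromℕ≡mkℚ m) (fromℕ≡mkℚ n))
  (cong (_/ 1) (cong₂ ℤ._+_ (ℤ.*-identityʳ (+ m)) (ℤ.*-identityʳ (+ n)))))

fromℕ-homo-* : ∀ m n → fromℕ (m ℕ.* n) ≡ fromℕ m * fromℕ n
fromℕ-homo-* m n = sym (trans
  (cong₂ _*_ (fromℕ≡mkℚ m) (fromℕ≡mkℚ n))
  (cong (_/ 1) (sym (ℤ.pos-* m n))))

fromℕ-cancel-< : ∀ {m n} → fromℕ m < fromℕ n → m ℕ.< n
fromℕ-cancel-< {m} {n} m<n = ℤ.drop‿+<+ (subst₂ ℤ._<_
  (ℤ.*-identityʳ (+ m)) (ℤ.*-identityʳ (+ n))
  (drop-*<* (subst₂ _<_ (fromℕ≡mkℚ m) (fromℕ≡mkℚ n) m<n)))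

0≤fromℕ : ∀ n → 0ℚ ≤ fromℕ n
0≤fromℕ n = nonNegative⁻¹ (fromℕ n) {{normalize-nonNeg n 1}}

square-mono-< : ∀ {q r} → 0ℚ ≤ q → q < r → q * q < r * r
square-mono-< {q} {r} 0≤q q<r = ≤-<-trans
  (*-monoˡ-≤-nonNeg q {{nonNegative 0≤q}} (<⇒≤ q<r))
  (*-monoˡ-<-pos r {{positive (≤-<-trans 0≤q q<r)}} q<r)

open +-*-Solver

-- In terms of s = k + 1 the conclusion is s² − s + 1 < n, that is
-- (s − ½)² < n − ¾.
quotientCount<order : ∀ n k {r} → fromℕ (suc k) - ½ < r →
  ℝ.L (√ (fromℕ n - + 3 / 4)) r → suc (suc k ℕ.* k) ℕ.< n
quotientCount<order n k {r} s-½<r Lr = fromℕ-cancel-<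
  (subst₂ _<_ lhs≡ rhs≡ (+-monoˡ-< (+ 3 / 4) ([s-½]²< Lr)))
  where
  κ s : ℚ
  κ = fromℕ k
  s = fromℕ (suc k)

  s≡1+κ : s ≡ 1ℚ + κ
  s≡1+κ = fromℕ-homo-+ 1 k

  0≤s-½ : 0ℚ ≤ s - ½
  0≤s-½ = subst (0ℚ ≤_)
    (trans (solve 1 (λ κ → con ½ :+ κ := con 1ℚ :+ κ :- con ½) refl κ)
           (cong (_- ½) (sym s≡1+κ)))
    (+-mono-≤ (nonNegative⁻¹ ½) (0≤fromℕ k))

  [s-½]²< : ℝ.L (√ (fromℕ n - + 3 / 4)) r → (s - ½) * (s - ½) < fromℕ n - + 3 / 4
  -- Every negative rational lies in the lower cut of a root, but here `r` exceeds the nonnegative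
  -- `s - ½`.
  [s-½]²< (inj₁ r<0)  =
    contradiction (≤-<-trans 0≤s-½ (<-trans s-½<r r<0)) (<-irrefl refl)
  [s-½]²< (inj₂ r²<)  = <-trans (square-mono-< 0≤s-½ s-½<r) r²<

  lhs≡ : (s - ½) * (s - ½) + + 3 / 4 ≡ fromℕ (suc (suc k ℕ.* k))
  lhs≡ = trans
    (cong (λ s → (s - ½) * (s - ½) + + 3 / 4) s≡1+κ)
    (trans
      (solve 1 (λ κ →
          (con 1ℚ :+ κ :- con ½) :* (con 1ℚ :+ κ :- con ½) :+ con (+ 3 / 4)
          := con 1ℚ :+ (con 1ℚ :+ κ) :* κ)
        refl κ)
      (trans
        (cong (λ s → 1ℚ + s * κ) (sym s≡1+κ))
        (trans
          (cong (λ x → 1ℚ + x) (sym (fromℕ-homo-* (suc k) k)))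
          (sym (fromℕ-homo-+ 1 (suc k ℕ.* k))))))

  rhs≡ : fromℕ n - + 3 / 4 + + 3 / 4 ≡ fromℕ n
  rhs≡ = solve 1 (λ x → x :- con (+ 3 / 4) :+ con (+ 3 / 4) := x) refl (fromℕ n)

-- A section of `f` would inject `Fin n` into `Fin m`, so `f` is not surjective; being hit is
-- decidable, so a missed value can be found by search.
missed-value : ∀ {m n} (f : Fin m → Fin n) → m ℕ.< n → ∃ λ y → ∀ i → f i ≢ y
missed-value {m} {n} f m<n =
  let y , ¬hit = ¬∀⟶∃¬ n (λ y → ∃ λ i → f i ≡ y) (λ y → any? (λ i → f i ≟ y)) ¬surjective
  in y , λ i fi≡y → ¬hit (i , fi≡y)
  where
  ¬surjective : ¬ (∀ y → ∃ λ i → f i ≡ y)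
  ¬surjective section = ℕ.<⇒≱ m<n (injective⇒≤ {f = proj₁ ∘ section} λ {y} {z} eq →
    trans (sym (proj₂ (section y))) (trans (cong f eq) (proj₂ (section z))))

-- Induction on `m`: deleting `f zero` from the codomain with `punchOut` leaves an injection of the
-- remaining indices, and `punchIn` carries the enumeration of its complement back.
enumerate-complement : ∀ {m n} (f : Fin m → Fin n) → Injective _≡_ _≡_ f →
  ∃ λ (g : Fin (n ℕ.∸ m) → Fin n) → ∀ y → (∀ i → f i ≢ y) → ∃ λ j → g j ≡ y
enumerate-complement {zero}              f f-inj = (λ y → y) , λ y _ → y , refl
enumerate-complement {suc m} {zero}      f f-inj = contradiction (f zero) λ ()
enumerate-complement {suc m} {suc n} f f-inj =
  punchIn (f zero) ∘ proj₁ rest , λ y misses →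
    let j , gj≡ = proj₂ rest (punchOut (misses zero)) λ i eq →
          misses (suc i) (punchOut-injective (f₀≢ i) (misses zero) eq)
    in j , trans (cong (punchIn (f zero)) gj≡) (punchIn-punchOut (misses zero))
  where
  f₀≢ : ∀ i → f zero ≢ f (suc i)
  f₀≢ i eq with () ← f-inj eq

  rest = enumerate-complement (λ i → punchOut (f₀≢ i)) λ {i} {j} eq →
    suc-injective (f-inj (punchOut-injective (f₀≢ i) (f₀≢ j) eq))

module FiniteGroup {c ℓ} (G : Group c ℓ) {n} (sizeG : HasSize (Group.setoid G) n) where
  open Group G
    using (Carrier; _≈_; _∙_; ε; _⁻¹; _//_; setoid; ∙-congˡ; identityˡ;
           inverseʳ)
  module ≈ = Group G using (refl; sym; trans; reflexive)
  open GroupProperties G using (x≈z//y; \\-leftDividesˡ)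
  open Inverse sizeG using (to; from; to-cong; strictlyInverseˡ; strictlyInverseʳ)

  index-injective : ∀ {x y} → to x ≡ to y → x ≈ y
  index-injective = Injection.injective (Inverse⇒Injection sizeG)

  -- `f i ≈ g ∙ f j` means that `g` is `f i // f j`, so any `g` outside the list of quotients will
  -- do.
  translate-misses : ∀ {k} (f : Fin (suc k) → Carrier) → suc (suc k ℕ.* k) ℕ.< n →
    ∃ λ g → ∀ i j → ¬ (f i ≈ g ∙ f j)
  translate-misses {k} f small =
    let y , missed = missed-value (to ∘ quotient) small in
    from y , λ i j fi≈gfj →
      let p , qp≈ = hit i j in
      missed p (trans
        (to-cong (≈.trans qp≈ (≈.sym (x≈z//y (from y) (f j) (f i) (≈.sym fi≈gfj)))))
        (strictlyInverseˡ y))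
    where
    -- `punchIn i` runs through the indices other than `i`.
    offDiagonal : Fin (suc k) × Fin k → Carrier
    offDiagonal (i , j) = f i // f (punchIn i j)

    -- The single index `zero` serves the whole diagonal: with s = k + 1 there are s(s - 1) + 1
    -- entries instead of s².
    quotient : Fin (suc (suc k ℕ.* k)) → Carrier
    quotient zero    = ε
    quotient (suc p) = offDiagonal (remQuot k p)

    hit : ∀ i j → ∃ λ p → quotient p ≈ f i // f j
    hit i j with i ≟ j
    ... | yes refl = zero , ≈.sym (inverseʳ (f i))
    ... | no  i≢j  = suc (combine i (punchOut i≢j)) , ≈.reflexive (trans
      (cong offDiagonal (remQuot-combine i (punchOut i≢j)))
      (cong (λ j → f i // f j) (punchIn-punchOut i≢j)))

  module _ {p} {X : Pred Carrier p} {m} (sizeX : HasSize (subsetoid setoid X) m) where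
    private module X = Inverse sizeX

    element : Fin m → Carrier
    element i = proj₁ (X.from i)

    element∈X : ∀ i → element i ∈ X
    element∈X i = proj₂ (X.from i)

    index∈X : ∀ {x} → x ∈ X → ∃ λ i → element i ≈ x
    index∈X {x} x∈X = X.to (x , x∈X) , X.strictlyInverseʳ (x , x∈X)

    -- Members of `X` with the same index in `G` are equal in `G`, hence in the subsetoid, whose
    -- equality is the same.
    element-injective : Injective _≡_ _≡_ (to ∘ element)
    element-injective {i} {j} eq = trans
      (sym (X.strictlyInverseˡ i))
      (trans (X.to-cong (index-injective eq)) (X.strictlyInverseˡ j))

    size≤order : m ℕ.≤ n
    size≤order = injective⇒≤ element-injective

    module _ (resp : X Respects _≈_) where

      -- Membership is a finite search through the enumeration of `X`, with elements compared by
      -- their indices in `Fin n`.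
      ∈X? : Decidable X
      ∈X? x = map′
        (λ (i , eq) → resp (index-injective eq) (element∈X i))
        (λ x∈X → let i , eq = index∈X x∈X in i , to-cong eq)
        (any? λ i → to (element i) ≟ to x)

      -- The size enters through an equation so that it can be taken as `0` or as a successor.
      complement-enumeration : ∀ {k} → n ℕ.∸ m ≡ k →
        ∃ λ (f : Fin k → Carrier) → ∀ {y} → ¬ y ∈ X → ∃ λ j → f j ≈ y
      complement-enumeration refl =
        let g , g-covers = enumerate-complement (to ∘ element) element-injective in
        from ∘ g , λ {y} y∉X →
          let j , gj≡ = g-covers (to y) λ i eq →
                y∉X (resp (index-injective eq) (element∈X i))
          in j , index-injective (trans (strictlyInverseˡ (g j)) gj≡)

      full-size⇒universal : n ℕ.∸ m ≡ 0 → Universal X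
      full-size⇒universal n∸m≡0 y = decidable-stable (∈X? y) λ y∉X →
        -- An element outside `X` would have an index in `Fin 0`.
        contradiction (proj₁ (proj₂ (complement-enumeration n∸m≡0) y∉X)) λ ()

      small-complement⇒generic : ∀ {k} → n ℕ.∸ m ≡ suc k → suc (suc k ℕ.* k) ℕ.< n →
        IsGeneric G 2 X
      small-complement⇒generic n∸m≡1+k small =
        (λ { zero → ε ; (suc zero) → g }) , λ y → cover y (∈X? y) (∈X? (g ⁻¹ ∙ y))
        where
        complement = complement-enumeration n∸m≡1+k
        avoided = translate-misses (proj₁ complement) small

        g : Carrier
        g = proj₁ avoided

        g[g⁻¹y]≈y : ∀ y → g ∙ (g ⁻¹ ∙ y) ≈ y
        g[g⁻¹y]≈y = \\-leftDividesˡ g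

        cover : ∀ y → Dec (y ∈ X) → Dec ((g ⁻¹ ∙ y) ∈ X) → _
        cover y (yes y∈X) _         = zero , y , y∈X , ≈.sym (identityˡ y)
        cover y (no _)    (yes z∈X) = suc zero , g ⁻¹ ∙ y , z∈X , ≈.sym (g[g⁻¹y]≈y y)
        -- Both `y` and `g ⁻¹ ∙ y` would lie in the complement, yet `g` carries the second to the
        -- first.
        cover y (no y∉X)  (no z∉X)  =
          let i , fi≈y = proj₂ complement y∉X
              j , fj≈z = proj₂ complement z∉X
          in contradiction
               (≈.trans fi≈y (≈.sym (≈.trans (∙-congˡ fj≈z) (g[g⁻¹y]≈y y))))
               (proj₂ avoided i j)

  -- A common point of the translates by `ε` and `g` would make `g` a quotient of two elements of
  -- `X`.
  small⇒¬large : ∀ {p k} {X : Pred Carrier p} → HasSize (subsetoid setoid X) (suc k) →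
    suc (suc k ℕ.* k) ℕ.< n → ¬ IsLarge G 2 X
  small⇒¬large sizeX small large =
    let g , missed = translate-misses (element sizeX) small
        y , common = large λ { zero → ε ; (suc zero) → g }
        x , x∈X , y≈εx = common zero
        z , z∈X , y≈gz = common (suc zero)
        i , ei≈x = index∈X sizeX x∈X
        j , ej≈z = index∈X sizeX z∈X
    in missed i j (≈.trans ei≈x (≈.trans (≈.sym (identityˡ x))
         (≈.trans (≈.sym y≈εx) (≈.trans y≈gz (∙-congˡ (≈.sym ej≈z))))))

theorem2p8 : ∀ {c ℓ p} (G : Group c ℓ) (n : ℕ) → HasSize (Group.setoid G) n →
    (X : Pred (Group.Carrier G) p) → X Respects (Group._≈_ G) →
    Satisfiable X → ¬ Universal X →
    (m : ℕ) → HasSize (subsetoid (Group.setoid G) X) m →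
    (fromℚ (fromℕ m) >ℝ (fromℕ n - ½) -ℝ (√ (fromℕ n - + 3 / 4)) → IsGeneric G 2 X)
    × (fromℚ (fromℕ m) <ℝ ½ +ℝ (√ (fromℕ n - + 3 / 4)) → ¬ IsLarge G 2 X)
theorem2p8 G n sizeG X resp (x , x∈X) ¬universal m sizeX =
  generic (n ℕ.∸ m) refl , ¬large m sizeX
  where
  open FiniteGroup G sizeG

  -- Here `k` is the size of the complement; it is positive because `X` is proper.
  generic : ∀ k → n ℕ.∸ m ≡ k →
    fromℚ (fromℕ m) >ℝ (fromℕ n - ½) -ℝ (√ (fromℕ n - + 3 / 4)) → IsGeneric G 2 X
  generic zero    n∸m≡0   _              =
    contradiction (full-size⇒universal sizeX resp n∸m≡0) ¬universal
  generic (suc k) n∸m≡1+k (q , Lq , q<m) =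
    small-complement⇒generic sizeX resp n∸m≡1+k (quotientCount<order n k s-½< Lq)
    where
    n≡ : fromℕ n ≡ fromℕ (suc k) + fromℕ m
    n≡ = trans
      (cong fromℕ (trans (sym (ℕ.m∸n+n≡m (size≤order sizeX))) (cong (ℕ._+ m) n∸m≡1+k)))
      (fromℕ-homo-+ (suc k) m)

    -- By the definition of `_-ℝ_`, `Lq` puts n - ½ - q in the lower cut of the root; since q < m,
    -- it exceeds n - ½ - m, which is s - ½ for s = n - m.
    s-½< : fromℕ (suc k) - ½ < (fromℕ n - ½) - q
    s-½< = subst (_< (fromℕ n - ½) - q)
      (trans
        (cong (λ x → x - ½ - fromℕ m) n≡)
        (solve 2 (λ s μ → s :+ μ :- con ½ :- μ := s :- con ½) refl (fromℕ (suc k)) (fromℕ m)))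
      (+-monoʳ-< (fromℕ n - ½) (neg-antimono-< q<m))

  -- `m` is quantified anew to be split on; the element `x` of `X` excludes `0`.
  ¬large : ∀ m → HasSize (subsetoid (Group.setoid G) X) m →
    fromℚ (fromℕ m) <ℝ ½ +ℝ (√ (fromℕ n - + 3 / 4)) → ¬ IsLarge G 2 X
  ¬large zero    sizeX _              = contradiction (Inverse.to sizeX (x , x∈X)) λ ()
  ¬large (suc k) sizeX (q , m<q , Lq) =
    -- By the definition of `_+ℝ_`, `Lq` puts `q - ½` in the lower cut of the root.
    small⇒¬large sizeX (quotientCount<order n k (+-monoˡ-< (- ½) m<q) Lq)
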